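{- $\mathsf{RT}^1_3\le_\mathrm{sW}\mathsf{ADC}$.
   Context: Problems are multi-valued partial functions $\subseteq\omega^\omega\rightrightarrows\omega^\omega$ with standard codings. $\mathcal{F}\le_\mathrm{sW}\mathcal{G}$ if there are Turing functionals $\Phi,\Psi$ with $\Phi(f)\in\mathrm{dom}(\mathcal{G})$ for all $f\in\mathrm{dom}(\mathcal{F})$ and $\Psi(g)\in\mathcal{F}(f)$ for all $f\in\mathrm{dom}(\mathcal F)$, $g\in\mathcal{G}(\Phi(f))$. $\mathsf{RT}^1_3$: input $c\colon\omega\to\{0,1,2\}$; output an infinite $H\subseteq\omega$ on which $c$ is constant. $\mathsf{ADC}$: input an infinite linear order $(L,<_L)$ with $L\subseteq\omega$; output an infinite $S\subseteq L$ that is an ascending chain ($\{x\in S:x<_Ly\}$ finite for every $y\in S$) or a descending chain ($\{x\in S:y<_Lx\}$ finite for every $y\in S$). -}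

module Defs where

open import Data.Nat using (ℕ; zero; suc; _+_; _≤_; _<_)
open import Data.Fin using (Fin)
open import Data.Vec using (Vec; []; _∷_; lookup)
open import Data.Product using (Σ; ∃; _×_)
open import Data.Sum using (_⊎_)
open import Relation.Binary.PropositionalEquality using (_≡_; _≢_)

Baire : Set
Baire = ℕ → ℕ

-- Turing functionals: codes of partial recursive functions with an
-- oracle (Kleene's oracle μ-recursive functions).  A code is a finite
-- syntactic object, so only countably many functionals exist and they
-- are exactly the Turing functionals.

data Code : ℕ → Set where
  zer : ∀ {n} → Code n
  sucᶜ : Code 1
  prj : ∀ {n} → Fin n → Code n
  orc : Code 1
  cmp : ∀ {m n} → Code m → Vec (Code n) m → Code n
  rec : ∀ {n} → Code n → Code (suc (suc n)) → Code (suc n)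
  mnz : ∀ {n} → Code (suc n) → Code n

-- Big-step semantics relative to the oracle f (partial: a computation
-- converges iff a derivation exists).
mutual
  data Eval (f : Baire) : ∀ {n} → Code n → Vec ℕ n → ℕ → Set where
    ev-zer : ∀ {n} {xs : Vec ℕ n} → Eval f zer xs 0
    ev-suc : ∀ {x} → Eval f sucᶜ (x ∷ []) (suc x)
    ev-prj : ∀ {n} {i : Fin n} {xs : Vec ℕ n} → Eval f (prj i) xs (lookup xs i)
    ev-orc : ∀ {x} → Eval f orc (x ∷ []) (f x)
    ev-cmp : ∀ {m n} {h : Code m} {gs : Vec (Code n) m} {xs : Vec ℕ n}
               {ys : Vec ℕ m} {z : ℕ} →
             Evals f gs xs ys → Eval f h ys z → Eval f (cmp h gs) xs z
    ev-rec0 : ∀ {n} {g : Code n} {h : Code (suc (suc n))} {xs : Vec ℕ n} {z : ℕ} →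
              Eval f g xs z → Eval f (rec g h) (0 ∷ xs) z
    ev-recS : ∀ {n} {g : Code n} {h : Code (suc (suc n))} {xs : Vec ℕ n}
                {k z w : ℕ} →
              Eval f (rec g h) (k ∷ xs) z → Eval f h (k ∷ z ∷ xs) w →
              Eval f (rec g h) (suc k ∷ xs) w
    ev-mnz : ∀ {n} {g : Code (suc n)} {xs : Vec ℕ n} {y : ℕ} →
             Eval f g (y ∷ xs) 0 →
             (∀ z → z < y → ∃ λ v → Eval f g (z ∷ xs) (suc v)) →
             Eval f (mnz g) xs y

  data Evals (f : Baire) : ∀ {m n} → Vec (Code n) m → Vec ℕ n → Vec ℕ m → Set where
    evs-[] : ∀ {n} {xs : Vec ℕ n} → Evals f [] xs []
    evs-∷ : ∀ {m n} {g : Code n} {gs : Vec (Code n) m} {xs : Vec ℕ n}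
              {y : ℕ} {ys : Vec ℕ m} →
            Eval f g xs y → Evals f gs xs ys → Evals f (g ∷ gs) xs (y ∷ ys)

_⟦_⟧≡_ : Code 1 → Baire → Baire → Set
e ⟦ f ⟧≡ g = ∀ n → Eval f e (n ∷ []) (g n)

record Problem : Set₁ where
  field
    dom : Baire → Set
    sol : Baire → Baire → Set     -- sol f g : g ∈ P(f)

open Problem

_≤sW_ : Problem → Problem → Set
F ≤sW G = Σ (Code 1) λ Φ → Σ (Code 1) λ Ψ →
  ∀ f → dom F f →
    Σ Baire λ d → (Φ ⟦ f ⟧≡ d) × dom G d ×
      (∀ g → sol G d g → Σ Baire λ h → (Ψ ⟦ g ⟧≡ h) × sol F f h)

IsSetCode : Baire → Set
IsSetCode s = ∀ n → s n ≤ 1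

_∈ₛ_ : ℕ → Baire → Set
x ∈ₛ s = s x ≡ 1

InfiniteSet : Baire → Set
InfiniteSet s = ∀ n → ∃ λ m → n ≤ m × m ∈ₛ s

RT13 : Problem
RT13 = record
  { dom = λ c → ∀ n → c n < 3
  ; sol = λ c h → IsSetCode h × InfiniteSet h ×
                  ∃ λ i → ∀ m → m ∈ₛ h → c m ≡ i
  }

-- ADC.  Pairing ⟨x,y⟩ (Cantor) and linear orders coded by the
-- characteristic function of ≤_L on ω (x ∈ L iff x ≤_L x).

tri : ℕ → ℕ
tri zero = zero
tri (suc k) = suc k + tri k

pair : ℕ → ℕ → ℕ
pair x y = tri (x + y) + y

module LinOrd (d : Baire) where
  _≤L_ : ℕ → ℕ → Set
  x ≤L y = d (pair x y) ≡ 1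

  InL : ℕ → Set
  InL x = x ≤L x

  _<L_ : ℕ → ℕ → Set
  x <L y = x ≤L y × x ≢ y

  IsLinearOrder : Set
  IsLinearOrder =
    (∀ n → d n ≤ 1) ×
    (∀ x y → x ≤L y → InL x × InL y) ×
    (∀ x y → x ≤L y → y ≤L x → x ≡ y) ×
    (∀ x y z → x ≤L y → y ≤L z → x ≤L z) ×
    (∀ x y → InL x → InL y → x ≤L y ⊎ y ≤L x)

  InfiniteL : Set
  InfiniteL = ∀ n → ∃ λ m → n ≤ m × InL m

  FinBelow : Baire → ℕ → Set
  FinBelow s y = ∃ λ b → ∀ x → x ∈ₛ s → x <L y → x < b

  FinAbove : Baire → ℕ → Set
  FinAbove s y = ∃ λ b → ∀ x → x ∈ₛ s → y <L x → x < b

  Ascending : Baire → Set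
  Ascending s = ∀ y → y ∈ₛ s → FinBelow s y

  Descending : Baire → Set
  Descending s = ∀ y → y ∈ₛ s → FinAbove s y

ADC : Problem
ADC = record
  { dom = λ d → LinOrd.IsLinearOrder d × LinOrd.InfiniteL d
  ; sol = λ d s → IsSetCode s × InfiniteSet s ×
                  (∀ x → x ∈ₛ s → LinOrd.InL d x) ×
                  (LinOrd.Ascending d s ⊎ LinOrd.Descending d s)
  }

{-# OPTIONS --safe #-}
module Submission where

-- Scan a 3-colouring f with a counter, the phase, that goes up by one whenever the
-- colour read equals the phase modulo 3; the point read belongs to the new phase, so
-- phase p contains only the colours p + 1 and p + 2 modulo 3.  Each phase is placed
-- around all the earlier ones: its points of colour p + 1 form an ascending sequence
-- below them, those of colour p + 2 a descending sequence above them.  If the phase is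
-- eventually constant, an infinite ascending (descending) chain lies in the lower (upper)
-- half of the last phase, so its points have a single colour, which recurs.  If the phase
-- is unbounded, every colour recurs.  Either way the colour of any point of a chain
-- recurs.  The n-th point is the number whose base-3 digits, from the least significant
-- one, are f n, f 0, …, f (n - 1), 1, so a chain computes f, and with it the set of all
-- numbers of that colour.

open import Defs
open import Data.Nat using (ℕ; zero; suc; pred; _+_; _*_; _∸_; _^_; _/_; _%_; _≤_; _<_; _⊔_; z≤n; s≤s)
open import Data.Nat.Properties
open import Data.Nat.DivMod using (%-distribˡ-+; m≡m%n+[m/n]*n; +-distrib-/-∣ʳ; m*n/n≡m; m%n<n; [m+kn]%n≡m%n; m<n⇒m%n≡m; m<n⇒m/n≡0)
open import Data.Nat.Divisibility using (n∣m*n)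
open import Data.Nat.Tactic.RingSolver using (solve-∀)
open import Data.Fin using (Fin)
open import Data.Fin.Patterns using (0F; 1F; 2F)
open import Data.Vec using (Vec; []; _∷_; lookup; head; tail)
open import Data.Product using (∃; _×_; _,_; proj₁; proj₂)
open import Data.Sum using (_⊎_; inj₁; inj₂)
open import Data.Empty using (⊥; ⊥-elim)
open import Function using (_∘_; id; flip)
open import Relation.Nullary using (¬_; Dec; yes; no)
open import Relation.Binary.Definitions using (tri<; tri≈; tri>)
open import Relation.Binary.PropositionalEquality using (_≡_; refl; sym; trans; cong; cong₂; subst; subst₂; module ≡-Reasoning)

-- Computable functions and decidable predicates

Fun : ℕ → Set
Fun n = Baire → Vec ℕ n → ℕ

-- Captures functionals that are total for every oracle. The partial operator `mnz` is handled apart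
-- from these, by `minimize`.
record Computable {n} (F : Fun n) : Set where
  constructor computable
  field
    code : Code n
    correct : ∀ f xs → Eval f code xs (F f xs)

open Computable

var : ∀ {n} (i : Fin n) → Computable (λ f xs → lookup xs i)
var i = computable (prj i) λ f xs → ev-prj

compose₁ : ∀ {n} {H : Fun 1} {F : Fun n} → Computable H → Computable F →
           Computable (λ f xs → H f (F f xs ∷ []))
compose₁ h g = computable (cmp (code h) (code g ∷ []))
  λ f xs → ev-cmp (evs-∷ (correct g f xs) evs-[]) (correct h f _)

compose₂ : ∀ {n} {H : Fun 2} {F G : Fun n} → Computable H → Computable F → Computable G →
           Computable (λ f xs → H f (F f xs ∷ G f xs ∷ []))
compose₂ h g k = computable (cmp (code h) (code g ∷ code k ∷ []))
  λ f xs → ev-cmp (evs-∷ (correct g f xs) (evs-∷ (correct k f xs) evs-[])) (correct h f _)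

sucC : ∀ {n} {F : Fun n} → Computable F → Computable (λ f xs → suc (F f xs))
sucC = compose₁ {H = λ f xs → suc (head xs)} (computable sucᶜ λ { f (x ∷ []) → ev-suc })

oracleC : ∀ {n} {F : Fun n} → Computable F → Computable (λ f xs → f (F f xs))
oracleC = compose₁ {H = λ f xs → f (head xs)} (computable orc λ { f (x ∷ []) → ev-orc })

constC : ∀ {n} k → Computable {n} (λ f xs → k)
constC zero    = computable zer λ f xs → ev-zer
constC (suc k) = sucC (constC k)

-- The recursion equations are hypotheses on a given `T`, so functions not defined by primitive
-- recursion, such as `_%_` and `_/_`, are covered once the equations are proved.
primrec : ∀ {n} {G : Fun n} {H : Fun (suc (suc n))} (T : Baire → ℕ → Vec ℕ n → ℕ) →
          Computable G → Computable H →
          (∀ f xs → T f 0 xs ≡ G f xs) →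
          (∀ f k xs → T f (suc k) xs ≡ H f (k ∷ T f k xs ∷ xs)) →
          Computable (λ f xs → T f (head xs) (tail xs))
primrec {G = G} {H} T g h base step = computable (rec (code g) (code h)) λ { f (k ∷ xs) → go f k xs }
  where
  go : ∀ f k xs → Eval f (rec (code g) (code h)) (k ∷ xs) (T f k xs)
  go f zero    xs = subst (Eval f _ _) (sym (base f xs)) (ev-rec0 (correct g f xs))
  go f (suc k) xs = subst (Eval f _ _) (sym (step f k xs)) (ev-recS (go f k xs) (correct h f _))

primrec₁ : ∀ {G : Fun 0} {H : Fun 2} (T : Baire → ℕ → ℕ) → Computable G → Computable H →
           (∀ f → T f 0 ≡ G f []) → (∀ f k → T f (suc k) ≡ H f (k ∷ T f k ∷ [])) →
           ∀ {n} {F : Fun n} → Computable F → Computable (λ f xs → T f (F f xs))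
primrec₁ T g h base step =
  compose₁ (primrec (λ f k _ → T f k) g h (λ { f [] → base f }) (λ { f k [] → step f k }))

primrec₂ : ∀ {G : Fun 1} {H : Fun 3} (T : Baire → ℕ → ℕ → ℕ) → Computable G → Computable H →
           (∀ f x → T f 0 x ≡ G f (x ∷ [])) →
           (∀ f k x → T f (suc k) x ≡ H f (k ∷ T f k x ∷ x ∷ [])) →
           ∀ {n} {F F′ : Fun n} → Computable F → Computable F′ →
           Computable (λ f xs → T f (F f xs) (F′ f xs))
primrec₂ T g h base step =
  compose₂ (primrec (λ f k xs → T f k (head xs)) g h
             (λ { f (x ∷ []) → base f x }) (λ { f k (x ∷ []) → step f k x }))

infixl 6 _+C_ _∸C_
infixl 7 _*C_

_+C_ : ∀ {n} {F G : Fun n} → Computable F → Computable G → Computable (λ f xs → F f xs + G f xs)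
_+C_ = primrec₂ (λ f → _+_) (var 0F) (sucC (var 1F)) (λ _ _ → refl) (λ _ _ _ → refl)

_*C_ : ∀ {n} {F G : Fun n} → Computable F → Computable G → Computable (λ f xs → F f xs * G f xs)
_*C_ = primrec₂ (λ f → _*_) (constC 0) (var 2F +C var 1F) (λ _ _ → refl) (λ _ _ _ → refl)

predC : ∀ {n} {F : Fun n} → Computable F → Computable (λ f xs → pred (F f xs))
predC = primrec₁ (λ f → pred) (constC 0) (var 0F) (λ _ → refl) (λ _ _ → refl)

_∸C_ : ∀ {n} {F G : Fun n} → Computable F → Computable G → Computable (λ f xs → F f xs ∸ G f xs)
g ∸C h = primrec₂ (λ f k x → x ∸ k) (var 0F) (predC (var 1F))
           (λ _ _ → refl) (λ f k x → sym (pred[m∸n]≡m∸[1+n] x k)) h g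

-- Indexed by the value, so that matching on a proof also replaces the indicator by 1 or 0.
data Indicates (P : Set) : ℕ → Set where
  holds : P → Indicates P 1
  fails : ¬ P → Indicates P 0

module _ {P : Set} where

  indicator≤1 : ∀ {v} → Indicates P v → v ≤ 1
  indicator≤1 (holds _) = s≤s z≤n
  indicator≤1 (fails _) = z≤n

  indicator-sound : ∀ {v} → Indicates P v → v ≡ 1 → P
  indicator-sound (holds p) _ = p

  indicator-complete : ∀ {v} → Indicates P v → P → v ≡ 1
  indicator-complete (holds _)  _ = refl
  indicator-complete (fails ¬p) p = ⊥-elim (¬p p)

record Decidable {n} (P : Baire → Vec ℕ n → Set) : Set where
  constructor decidable
  field
    {χ} : Fun n
    χC : Computable χ
    indicates : ∀ f xs → Indicates (P f xs) (χ f xs)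

open Decidable

≤χ ≡χ : ℕ → ℕ → ℕ
≤χ a b = 1 ∸ (a ∸ b)
≡χ a b = ≤χ a b * ≤χ b a

≤χ-indicates : ∀ a b → Indicates (a ≤ b) (≤χ a b)
≤χ-indicates zero    b       = subst (λ v → Indicates (0 ≤ b) (1 ∸ v)) (sym (0∸n≡0 b)) (holds z≤n)
≤χ-indicates (suc a) zero    = subst (Indicates _) (sym (0∸n≡0 a)) (fails λ ())
≤χ-indicates (suc a) (suc b) with ≤χ a b | ≤χ-indicates a b
... | _ | holds p = holds (s≤s p)
... | _ | fails p = fails λ { (s≤s q) → p q }

×-indicates : ∀ {P Q u v} → Indicates P u → Indicates Q v → Indicates (P × Q) (u * v)
×-indicates (holds p) (holds q) = holds (p , q)
×-indicates (holds p) (fails q) = fails (q ∘ proj₂)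
×-indicates (fails p) _         = fails (p ∘ proj₁)

≡χ-indicates : ∀ a b → Indicates (a ≡ b) (≡χ a b)
≡χ-indicates a b with ≡χ a b | ×-indicates (≤χ-indicates a b) (≤χ-indicates b a)
... | _ | holds (p , q) = holds (≤-antisym p q)
... | _ | fails p       = fails λ { refl → p (≤-refl , ≤-refl) }

≤χC : ∀ {n} {F G : Fun n} → Computable F → Computable G → Computable (λ f xs → ≤χ (F f xs) (G f xs))
≤χC g h = constC 1 ∸C (g ∸C h)

≡χC : ∀ {n} {F G : Fun n} → Computable F → Computable G → Computable (λ f xs → ≡χ (F f xs) (G f xs))
≡χC g h = ≤χC g h *C ≤χC h g

module _ {n} {F G : Fun n} where

  infix 4 _≤D_ _<D_ _≡D_

  _≤D_ : Computable F → Computable G → Decidable (λ f xs → F f xs ≤ G f xs)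
  g ≤D h = decidable (≤χC g h) λ f xs → ≤χ-indicates (F f xs) (G f xs)

  _<D_ : Computable F → Computable G → Decidable (λ f xs → F f xs < G f xs)
  g <D h = decidable (≤χC (sucC g) h) λ f xs → ≤χ-indicates (suc (F f xs)) (G f xs)

  _≡D_ : Computable F → Computable G → Decidable (λ f xs → F f xs ≡ G f xs)
  g ≡D h = decidable (≡χC g h) λ f xs → ≡χ-indicates (F f xs) (G f xs)

module _ {n} {P Q : Baire → Vec ℕ n → Set} where

  infixr 3 _×D_
  infixr 2 _⊎D_

  _×D_ : Decidable P → Decidable Q → Decidable (λ f xs → P f xs × Q f xs)
  p ×D q = decidable (χC p *C χC q) λ f xs → ×-indicates (indicates p f xs) (indicates q f xs)

  _⊎D_ : Decidable P → Decidable Q → Decidable (λ f xs → P f xs ⊎ Q f xs)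
  p ⊎D q = decidable (≤χC (constC 1) (χC p +C χC q)) λ f xs → or (indicates p f xs) (indicates q f xs)
    where
    or : ∀ {A B u v} → Indicates A u → Indicates B v → Indicates (A ⊎ B) (≤χ 1 (u + v))
    or (holds a) (holds _) = holds (inj₁ a)
    or (holds a) (fails _) = holds (inj₁ a)
    or (fails a) (holds b) = holds (inj₂ b)
    or (fails a) (fails b) = fails λ { (inj₁ x) → a x ; (inj₂ x) → b x }

infix 3 ¬D_

¬D_ : ∀ {n} {P : Baire → Vec ℕ n → Set} → Decidable P → Decidable (λ f xs → ¬ P f xs)
¬D p = decidable (constC 1 ∸C χC p) λ f xs → not (indicates p f xs)
  where
  not : ∀ {A u} → Indicates A u → Indicates (¬ A) (1 ∸ u)
  not (holds a) = fails λ ¬a → ¬a a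
  not (fails a) = holds a

-- The known zero `y` bounds the search: test `P 0`, then search in `P ∘ suc`. Positivity below the
-- minimum is stated in the form that `ev-mnz` asks for.
least-zero : ∀ (P : ℕ → ℕ) y → P y ≡ 0 →
             ∃ λ x → P x ≡ 0 × (∀ z → z < x → ∃ λ v → P z ≡ suc v)
least-zero P y Py with P 0 in eq
... | zero = 0 , eq , λ _ ()
least-zero P zero    Py | suc v with () ← trans (sym eq) Py
least-zero P (suc y) Py | suc v with least-zero (P ∘ suc) y Py
... | x , Px , below = suc x , Px , λ { zero _ → v , eq ; (suc z) (s≤s z<x) → below z z<x }

minimize : ∀ {n} {G : Fun (suc n)} (g : Computable G) f xs {x} → G f (x ∷ xs) ≡ 0 →
           (∀ z → z < x → ∃ λ v → G f (z ∷ xs) ≡ suc v) → Eval f (mnz (code g)) xs x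
minimize g f xs Gx below = ev-mnz (subst (Eval f _ _) Gx (correct g f _))
  λ z z<x → let v , eq = below z z<x in v , subst (Eval f _ _) eq (correct g f _)

-- Division by three

<3-cases : ∀ (P : ℕ → Set) → P 0 → P 1 → P 2 → ∀ {r} → r < 3 → P r
<3-cases P p₀ p₁ p₂ {0} _ = p₀
<3-cases P p₀ p₁ p₂ {1} _ = p₁
<3-cases P p₀ p₁ p₂ {2} _ = p₂
<3-cases P p₀ p₁ p₂ {suc (suc (suc _))} (s≤s (s≤s (s≤s ())))

-- The factor `1 ∸ pred r` is 1 for the residues 0 and 1, and 0 for the residue 2, where the
-- remainder wraps around.
suc-%3 : ∀ n → suc n % 3 ≡ (1 ∸ pred (n % 3)) * suc (n % 3)
suc-%3 n = trans (%-distribˡ-+ 1 n 3)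
  (<3-cases (λ r → suc r % 3 ≡ (1 ∸ pred r) * suc r) refl refl refl (m%n<n n 3))

-- Splits off the multiple of 3, so that in `suc-/3` only the carry `1 ∸ suc n % 3` has to be
-- tabulated.
[r+q*3]/3 : ∀ r q → (r + q * 3) / 3 ≡ r / 3 + q
[r+q*3]/3 r q = trans (+-distrib-/-∣ʳ r (n∣m*n q)) (cong (r / 3 +_) (m*n/n≡m q 3))

suc-/3 : ∀ n → suc n / 3 ≡ (1 ∸ suc n % 3) + n / 3
suc-/3 n = begin
  suc n / 3                          ≡⟨ cong (λ k → suc k / 3) (m≡m%n+[m/n]*n n 3) ⟩
  (suc (n % 3) + n / 3 * 3) / 3      ≡⟨ [r+q*3]/3 (suc (n % 3)) (n / 3) ⟩
  suc (n % 3) / 3 + n / 3            ≡⟨ cong (_+ n / 3) (carry (m%n<n n 3)) ⟩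
  (1 ∸ suc (n % 3) % 3) + n / 3      ≡⟨ cong (λ k → (1 ∸ k) + n / 3) (sym (%-distribˡ-+ 1 n 3)) ⟩
  (1 ∸ suc n % 3) + n / 3            ∎
  where
  open ≡-Reasoning
  carry : ∀ {r} → r < 3 → suc r / 3 ≡ 1 ∸ suc r % 3
  carry = <3-cases (λ r → suc r / 3 ≡ 1 ∸ suc r % 3) refl refl refl

digit+3*-% : ∀ {r} q → r < 3 → (r + q * 3) % 3 ≡ r
digit+3*-% {r} q r<3 = trans ([m+kn]%n≡m%n r q 3) (m<n⇒m%n≡m r<3)

digit+3*-/ : ∀ {r} q → r < 3 → (r + q * 3) / 3 ≡ q
digit+3*-/ {r} q r<3 = trans ([r+q*3]/3 r q) (cong (_+ q) (m<n⇒m/n≡0 r<3))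

-- The offset `k` depends only on `p % 3` and `i`, so a table of nine entries suffices.
three-residues : ∀ p {i} → i < 3 → ∃ λ u → p ≤ u × u < 3 + p × i ≡ u % 3
three-residues p {i} i<3 = u , m≤n+m p k , +-monoˡ-< p k<3 , sym eq
  where
  Reached : ℕ → ℕ → Set
  Reached r i = ∃ λ k → k < 3 × (k % 3 + r) % 3 ≡ i
  0<3 : 0 < 3
  0<3 = s≤s z≤n
  1<3 : 1 < 3
  1<3 = s≤s (s≤s z≤n)
  2<3 : 2 < 3
  2<3 = s≤s (s≤s (s≤s z≤n))
  spread : ∀ {r} → r < 3 → ∀ {i} → i < 3 → Reached r i
  spread = <3-cases (λ r → ∀ {i} → i < 3 → Reached r i)
    (<3-cases (Reached 0) (0 , 0<3 , refl) (1 , 1<3 , refl) (2 , 2<3 , refl))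
    (<3-cases (Reached 1) (2 , 2<3 , refl) (0 , 0<3 , refl) (1 , 1<3 , refl))
    (<3-cases (Reached 2) (1 , 1<3 , refl) (2 , 2<3 , refl) (0 , 0<3 , refl))
  k = proj₁ (spread (m%n<n p 3) i<3)
  k<3 = proj₁ (proj₂ (spread (m%n<n p 3) i<3))
  u = k + p
  eq : u % 3 ≡ i
  eq = trans (%-distribˡ-+ k p 3) (proj₂ (proj₂ (spread (m%n<n p 3) i<3)))

-- Deletes the `k` least significant base-3 digits.
shift : ℕ → ℕ → ℕ
shift zero    x = x
shift (suc k) x = shift k x / 3

shift-suc : ∀ k x → shift (suc k) x ≡ shift k (x / 3)
shift-suc zero    x = refl
shift-suc (suc k) x = cong (_/ 3) (shift-suc k x)

%3C : ∀ {n} {F : Fun n} → Computable F → Computable (λ f xs → F f xs % 3)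
%3C = primrec₁ (λ f n → n % 3) (constC 0) ((constC 1 ∸C predC (var 1F)) *C sucC (var 1F))
        (λ _ → refl) (λ f → suc-%3)

/3C : ∀ {n} {F : Fun n} → Computable F → Computable (λ f xs → F f xs / 3)
/3C = primrec₁ (λ f n → n / 3) (constC 0) ((constC 1 ∸C %3C (sucC (var 0F))) +C var 1F)
        (λ _ → refl) (λ f → suc-/3)

shiftC : ∀ {n} {F G : Fun n} → Computable F → Computable G →
         Computable (λ f xs → shift (F f xs) (G f xs))
shiftC = primrec₂ (λ f → shift) (var 0F) (/3C (var 1F)) (λ _ _ → refl) (λ _ _ _ → refl)

-- Inverses of strictly increasing functions

-- For strictly increasing `v`, the greatest `s` with `v s ≤ p`, or 0 if there is none. It grows by
-- at most one when `p` does, so primitive recursion suffices.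
inverse : (ℕ → ℕ) → ℕ → ℕ
inverse v zero    = 0
inverse v (suc p) = ≤χ (v (suc (inverse v p))) (suc p) + inverse v p

inverseC : ∀ (v : Baire → ℕ → ℕ) → (∀ {n} {F : Fun n} → Computable F → Computable (λ f xs → v f (F f xs))) →
           ∀ {n} {F : Fun n} → Computable F → Computable (λ f xs → inverse (v f) (F f xs))
inverseC v vC = primrec₁ (λ f → inverse (v f)) (constC 0)
  (≤χC (vC (sucC (var 1F))) (sucC (var 0F)) +C var 1F) (λ _ → refl) (λ _ _ → refl)

module StrictlyIncreasing (v : ℕ → ℕ) (v-step : ∀ n → v n < v (suc n)) where

  mono-≤ : ∀ {m n} → m ≤ n → v m ≤ v n
  mono-≤ {m} {zero}  z≤n = ≤-refl
  mono-≤ {m} {suc n} m≤1+n with m≤n⇒m<n∨m≡n m≤1+n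
  ... | inj₁ (s≤s m≤n) = ≤-trans (mono-≤ m≤n) (<⇒≤ (v-step n))
  ... | inj₂ refl      = ≤-refl

  cancel-< : ∀ {m n} → v m < v n → m < n
  cancel-< {m} {n} vm<vn with <-≤-connex m n
  ... | inj₁ m<n = m<n
  ... | inj₂ n≤m = ⊥-elim (<⇒≱ vm<vn (mono-≤ n≤m))

  n≤vn : ∀ n → n ≤ v n
  n≤vn zero    = z≤n
  n≤vn (suc n) = ≤-<-trans (n≤vn n) (v-step n)

  -- The first alternative allows for arguments below `v 0`, where 0 is a default value.
  inverse-lower : ∀ p → inverse v p ≡ 0 ⊎ v (inverse v p) ≤ p
  inverse-lower zero = inj₁ refl
  inverse-lower (suc p) with ≤χ (v (suc (inverse v p))) (suc p) | ≤χ-indicates (v (suc (inverse v p))) (suc p)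
  ... | _ | holds le = inj₂ le
  ... | _ | fails _ with inverse-lower p
  ...   | inj₁ eq = inj₁ eq
  ...   | inj₂ le = inj₂ (m≤n⇒m≤1+n le)

  inverse-upper : ∀ p → p < v (suc (inverse v p))
  inverse-upper zero = n≤vn 1
  inverse-upper (suc p) with ≤χ (v (suc (inverse v p))) (suc p) | ≤χ-indicates (v (suc (inverse v p))) (suc p)
  ... | _ | holds le = ≤-<-trans (inverse-upper p) (v-step _)
  ... | _ | fails nle = ≰⇒> nle

  inverse-unique : ∀ {p s} → v s ≤ p → p < v (suc s) → inverse v p ≡ s
  inverse-unique {p} {s} lo hi = ≤-antisym upper (≤-pred (cancel-< (≤-<-trans lo (inverse-upper p))))
    where
    upper : inverse v p ≤ s
    upper with inverse-lower p
    ... | inj₁ eq = subst (_≤ s) (sym eq) z≤n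
    ... | inj₂ le = ≤-pred (cancel-< (≤-<-trans le hi))

  inverse-of : ∀ s → inverse v (v s) ≡ s
  inverse-of s = inverse-unique ≤-refl (v-step s)

-- Cantor unpairing

triC : ∀ {n} {F : Fun n} → Computable F → Computable (λ f xs → tri (F f xs))
triC = primrec₁ (λ f → tri) (constC 0) (sucC (var 0F) +C var 1F) (λ _ → refl) (λ _ _ → refl)

-- The codes of pairs with sum `s` run from `tri s` to `tri s + s`, so `diagonal` recovers the sum.
diagonal unpair₁ unpair₂ : ℕ → ℕ
diagonal  = inverse tri
unpair₂ p = p ∸ tri (diagonal p)
unpair₁ p = diagonal p ∸ unpair₂ p

diagonalC : ∀ {n} {F : Fun n} → Computable F → Computable (λ f xs → diagonal (F f xs))
diagonalC = inverseC (λ f → tri) triC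

unpair₂C : ∀ {n} {F : Fun n} → Computable F → Computable (λ f xs → unpair₂ (F f xs))
unpair₂C g = g ∸C triC (diagonalC g)

unpair₁C : ∀ {n} {F : Fun n} → Computable F → Computable (λ f xs → unpair₁ (F f xs))
unpair₁C g = diagonalC g ∸C unpair₂C g

module _ (x y : ℕ) where

  open StrictlyIncreasing tri (λ k → s≤s (m≤n+m (tri k) k))

  diagonal-pair : diagonal (pair x y) ≡ x + y
  diagonal-pair = inverse-unique (m≤m+n _ y)
    (s≤s (subst (tri (x + y) + y ≤_) (+-comm (tri (x + y)) (x + y)) (+-monoʳ-≤ (tri (x + y)) (m≤n+m y x))))

  unpair₂-pair : unpair₂ (pair x y) ≡ y
  unpair₂-pair rewrite diagonal-pair = m+n∸m≡n (tri (x + y)) y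

  unpair₁-pair : unpair₁ (pair x y) ≡ x
  unpair₁-pair rewrite unpair₂-pair | diagonal-pair = m+n∸n≡m x y

-- The linear order of a colouring

-- Adding (2 + f n) * 3 ^ n turns the leading digit 1 into f n and puts a new 1 before it.
prefix element : Baire → ℕ → ℕ
prefix f zero    = 1
prefix f (suc n) = (2 + f n) * 3 ^ n + prefix f n
element f n      = f n + prefix f n * 3

stage : Baire → ℕ → ℕ
stage f = inverse (element f)

-- The point n belongs to phase f (suc n), the phase after n has been read.
phase : Baire → ℕ → ℕ
phase f zero    = 0
phase f (suc n) = ≡χ (f n) (phase f n % 3) + phase f n

Lower : Baire → ℕ → Set
Lower f n = f n ≡ suc (phase f (suc n)) % 3

-- Says that `a` is at least as near as `b` to the cut between the lower and the upper half. Earlier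
-- phases are nearer; within a phase later points are nearer, so they ascend in the lower half and
-- descend in the upper one.
Inside : Baire → ℕ → ℕ → Set
Inside f a b = phase f (suc a) < phase f (suc b) ⊎ (phase f (suc a) ≡ phase f (suc b) × b ≤ a)

-- Lower points precede upper ones. Going up means towards the cut in the lower half and away from
-- it in the upper half, hence the swapped arguments of `Inside`.
_⊢_≼_ : Baire → ℕ → ℕ → Set
f ⊢ a ≼ b = (Lower f a × ¬ Lower f b) ⊎
            (Lower f a × Lower f b × Inside f b a) ⊎
            (¬ Lower f a × ¬ Lower f b × Inside f a b)

-- Membership in the range of `element f`, decided by one comparison at the only possible index.
IsElement : Baire → ℕ → Set
IsElement f x = element f (stage f x) ≡ x

_⊢_≤E_ : Baire → ℕ → ℕ → Set
f ⊢ x ≤E y = IsElement f x × IsElement f y × f ⊢ stage f x ≼ stage f y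

module _ {n} {F : Fun n} (g : Computable F) where

  prefixC : Computable (λ f xs → prefix f (F f xs))
  prefixC = primrec₁ prefix (constC 1) ((constC 2 +C oracleC (var 0F)) *C 3^C +C var 1F)
              (λ _ → refl) (λ _ _ → refl) g
    where
    3^C = primrec₁ (λ f → 3 ^_) (constC 1) (constC 3 *C var 1F) (λ _ → refl) (λ _ _ → refl) (var {2} 0F)

  phaseC : Computable (λ f xs → phase f (F f xs))
  phaseC = primrec₁ phase (constC 0) (≡χC (oracleC (var 0F)) (%3C (var 1F)) +C var 1F)
             (λ _ → refl) (λ _ _ → refl) g

elementC : ∀ {n} {F : Fun n} → Computable F → Computable (λ f xs → element f (F f xs))
elementC g = oracleC g +C prefixC g *C constC 3

stageC : ∀ {n} {F : Fun n} → Computable F → Computable (λ f xs → stage f (F f xs))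
stageC = inverseC element elementC

lowerD : ∀ {n} {F : Fun n} → Computable F → Decidable (λ f xs → Lower f (F f xs))
lowerD g = oracleC g ≡D %3C (sucC (phaseC (sucC g)))

insideD : ∀ {n} {F G : Fun n} → Computable F → Computable G →
          Decidable (λ f xs → Inside f (F f xs) (G f xs))
insideD g h = phaseC (sucC g) <D phaseC (sucC h) ⊎D
              (phaseC (sucC g) ≡D phaseC (sucC h) ×D h ≤D g)

≼D : ∀ {n} {F G : Fun n} → Computable F → Computable G → Decidable (λ f xs → f ⊢ F f xs ≼ G f xs)
≼D g h = (lowerD g ×D (¬D lowerD h)) ⊎D
         (lowerD g ×D lowerD h ×D insideD h g) ⊎D
         ((¬D lowerD g) ×D (¬D lowerD h) ×D insideD g h)

isElementD : ∀ {n} {F : Fun n} → Computable F → Decidable (λ f xs → IsElement f (F f xs))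
isElementD g = elementC (stageC g) ≡D g

≤ED : ∀ {n} {F G : Fun n} → Computable F → Computable G → Decidable (λ f xs → f ⊢ F f xs ≤E G f xs)
≤ED g h = isElementD g ×D isElementD h ×D ≼D (stageC g) (stageC h)

-- Abstract because its normal form is too large to compute.
abstract
  orderD : Decidable {1} (λ f xs → f ⊢ unpair₁ (lookup xs 0F) ≤E unpair₂ (lookup xs 0F))
  orderD = ≤ED (unpair₁C (var 0F)) (unpair₂C (var 0F))

order : Baire → Baire
order f p = χ orderD f (p ∷ [])

order-indicates : ∀ f p → Indicates (f ⊢ unpair₁ p ≤E unpair₂ p) (order f p)
order-indicates f p = indicates orderD f (p ∷ [])

module _ (f : Baire) (x y : ℕ) where

  open LinOrd (order f)

  private
    unpair-≤E : f ⊢ unpair₁ (pair x y) ≤E unpair₂ (pair x y) ≡ f ⊢ x ≤E y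
    unpair-≤E = cong₂ (f ⊢_≤E_) (unpair₁-pair x y) (unpair₂-pair x y)

  ≤L⇒≤E : x ≤L y → f ⊢ x ≤E y
  ≤L⇒≤E = subst id unpair-≤E ∘ indicator-sound (order-indicates f (pair x y))

  ≤E⇒≤L : f ⊢ x ≤E y → x ≤L y
  ≤E⇒≤L = indicator-complete (order-indicates f (pair x y)) ∘ subst id (sym unpair-≤E)

-- Order axioms

Inside-antisym : ∀ f {a b} → Inside f a b → Inside f b a → a ≡ b
Inside-antisym f (inj₁ p)       (inj₁ q)       = ⊥-elim (<-asym p q)
Inside-antisym f (inj₁ p)       (inj₂ (q , _)) = ⊥-elim (<-irrefl (sym q) p)
Inside-antisym f (inj₂ (p , _)) (inj₁ q)       = ⊥-elim (<-irrefl (sym p) q)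
Inside-antisym f (inj₂ (_ , p)) (inj₂ (_ , q)) = ≤-antisym q p

Inside-trans : ∀ f {a b c} → Inside f a b → Inside f b c → Inside f a c
Inside-trans f (inj₁ p)       (inj₁ q)        = inj₁ (<-trans p q)
Inside-trans f (inj₁ p)       (inj₂ (q , _))  = inj₁ (<-≤-trans p (≤-reflexive q))
Inside-trans f (inj₂ (p , _)) (inj₁ q)        = inj₁ (≤-<-trans (≤-reflexive p) q)
Inside-trans f (inj₂ (p , r)) (inj₂ (q , r′)) = inj₂ (trans p q , ≤-trans r′ r)

Inside-total : ∀ f a b → Inside f a b ⊎ Inside f b a
Inside-total f a b with <-cmp (phase f (suc a)) (phase f (suc b))
... | tri< p _ _ = inj₁ (inj₁ p)
... | tri> _ _ p = inj₂ (inj₁ p)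
... | tri≈ _ p _ with ≤-total a b
...   | inj₁ a≤b = inj₂ (inj₂ (sym p , a≤b))
...   | inj₂ b≤a = inj₁ (inj₂ (p , b≤a))

lower? : ∀ f n → Dec (Lower f n)
lower? f n = f n ≟ suc (phase f (suc n)) % 3

≼-antisym : ∀ f {a b} → f ⊢ a ≼ b → f ⊢ b ≼ a → a ≡ b
≼-antisym f (inj₁ (p , q))            (inj₁ (p′ , q′))           = ⊥-elim (q p′)
≼-antisym f (inj₁ (p , q))            (inj₂ (inj₁ (p′ , _)))     = ⊥-elim (q p′)
≼-antisym f (inj₁ (p , q))            (inj₂ (inj₂ (_ , q′ , _))) = ⊥-elim (q′ p)
≼-antisym f (inj₂ (inj₁ (p , _)))     (inj₁ (_ , q′))            = ⊥-elim (q′ p)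
≼-antisym f (inj₂ (inj₁ (_ , _ , i))) (inj₂ (inj₁ (_ , _ , j)))  = Inside-antisym f j i
≼-antisym f (inj₂ (inj₁ (p , _)))     (inj₂ (inj₂ (_ , q , _)))  = ⊥-elim (q p)
≼-antisym f (inj₂ (inj₂ (_ , q , _))) (inj₁ (p , _))             = ⊥-elim (q p)
≼-antisym f (inj₂ (inj₂ (_ , q , _))) (inj₂ (inj₁ (p , _)))      = ⊥-elim (q p)
≼-antisym f (inj₂ (inj₂ (_ , _ , i))) (inj₂ (inj₂ (_ , _ , j)))  = Inside-antisym f i j

≼-trans : ∀ f {a b c} → f ⊢ a ≼ b → f ⊢ b ≼ c → f ⊢ a ≼ c
≼-trans f (inj₁ (p , q))            (inj₁ (p′ , q′))           = ⊥-elim (q p′)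
≼-trans f (inj₁ (p , q))            (inj₂ (inj₁ (p′ , _)))     = ⊥-elim (q p′)
≼-trans f (inj₁ (p , q))            (inj₂ (inj₂ (_ , q′ , _))) = inj₁ (p , q′)
≼-trans f (inj₂ (inj₁ (p , _)))     (inj₁ (_ , q′))            = inj₁ (p , q′)
≼-trans f (inj₂ (inj₁ (p , _ , i))) (inj₂ (inj₁ (_ , q , j)))  = inj₂ (inj₁ (p , q , Inside-trans f j i))
≼-trans f (inj₂ (inj₁ (_ , p , _))) (inj₂ (inj₂ (q , _)))      = ⊥-elim (q p)
≼-trans f (inj₂ (inj₂ (_ , q , _))) (inj₁ (p , _))             = ⊥-elim (q p)
≼-trans f (inj₂ (inj₂ (_ , q , _))) (inj₂ (inj₁ (p , _)))      = ⊥-elim (q p)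
≼-trans f (inj₂ (inj₂ (p , _ , i))) (inj₂ (inj₂ (_ , q , j)))  = inj₂ (inj₂ (p , q , Inside-trans f i j))

≼-total : ∀ f a b → f ⊢ a ≼ b ⊎ f ⊢ b ≼ a
≼-total f a b with lower? f a | lower? f b | Inside-total f a b
... | yes p | no q  | _      = inj₁ (inj₁ (p , q))
... | no p  | yes q | _      = inj₂ (inj₁ (q , p))
... | yes p | yes q | inj₁ i = inj₂ (inj₂ (inj₁ (q , p , i)))
... | yes p | yes q | inj₂ i = inj₁ (inj₂ (inj₁ (p , q , i)))
... | no p  | no q  | inj₁ i = inj₁ (inj₂ (inj₂ (p , q , i)))
... | no p  | no q  | inj₂ i = inj₂ (inj₂ (inj₂ (q , p , i)))

≼-refl : ∀ f a → f ⊢ a ≼ a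
≼-refl f a with ≼-total f a a
... | inj₁ p = p
... | inj₂ p = p

-- Reading the colouring off an element

-- The definition adds digits at the most significant end; this unfolds the least significant one,
-- so that digits can be read by recursion on `f ∘ suc`.
prefix-suc : ∀ f n → prefix f (suc n) ≡ f 0 + prefix (f ∘ suc) n * 3
prefix-suc f zero    = base (f 0)
  where
  base : ∀ x → (2 + x) * 1 + 1 ≡ x + 1 * 3
  base = solve-∀
prefix-suc f (suc n) = trans (cong ((2 + f (suc n)) * 3 ^ suc n +_) (prefix-suc f n))
  (step (f (suc n)) (3 ^ n) (f 0) (prefix (f ∘ suc) n))
  where
  step : ∀ c w x p → (2 + c) * (3 * w) + (x + p * 3) ≡ x + ((2 + c) * w + p) * 3
  step = solve-∀

shift-zero : ∀ k → shift k 0 ≡ 0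
shift-zero zero    = refl
shift-zero (suc k) = cong (_/ 3) (shift-zero k)

shift-digit : ∀ k {r} q → r < 3 → shift (suc k) (r + q * 3) ≡ shift k q
shift-digit k q r<3 = trans (shift-suc k _) (cong (shift k) (digit+3*-/ q r<3))

Colouring : Baire → Set
Colouring f = ∀ n → f n < 3

shift-prefix-suc : ∀ {f} → Colouring f → ∀ k n → shift (suc k) (prefix f (suc n)) ≡ shift k (prefix (f ∘ suc) n)
shift-prefix-suc {f} f<3 k n = trans (cong (shift (suc k)) (prefix-suc f n)) (shift-digit k (prefix (f ∘ suc) n) (f<3 0))

prefix-positive : ∀ f n → 0 < prefix f n
prefix-positive f zero    = s≤s z≤n
prefix-positive f (suc n) = ≤-trans (prefix-positive f n) (m≤n+m _ _)

prefix-digit : ∀ {f} → Colouring f → ∀ {m n} → m < n → shift m (prefix f n) % 3 ≡ f m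
prefix-digit {f} f<3 {zero}  {suc n} _ = trans (cong (_% 3) (prefix-suc f n)) (digit+3*-% (prefix (f ∘ suc) n) (f<3 0))
prefix-digit {f} f<3 {suc m} {suc n} (s≤s m<n) =
  trans (cong (_% 3) (shift-prefix-suc f<3 m n)) (prefix-digit (f<3 ∘ suc) m<n)

-- The leading digit 1 of the prefix marks its length.
prefix-long : ∀ {f} → Colouring f → ∀ {m n} → m < n → 0 < shift (suc m) (prefix f n)
prefix-long {f} f<3 {zero}  {suc n} _ =
  subst (0 <_) (sym (shift-prefix-suc f<3 0 n)) (prefix-positive (f ∘ suc) n)
prefix-long {f} f<3 {suc m} {suc n} (s≤s m<n) =
  subst (0 <_) (sym (shift-prefix-suc f<3 (suc m) n)) (prefix-long (f<3 ∘ suc) m<n)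

prefix-short : ∀ {f} → Colouring f → ∀ {m n} → 0 < shift (suc m) (prefix f n) → m < n
prefix-short f<3 {m} {zero} pos =
  ⊥-elim (<-irrefl (sym (trans (shift-suc m 1) (shift-zero m))) pos)
prefix-short f<3 {zero}  {suc n} _ = s≤s z≤n
prefix-short f<3 {suc m} {suc n} pos =
  s≤s (prefix-short (f<3 ∘ suc) (subst (0 <_) (shift-prefix-suc f<3 (suc m) n) pos))

-- Phases

phase-≤suc : ∀ f n → phase f n ≤ phase f (suc n)
phase-≤suc f n = m≤n+m _ _

phase-mono : ∀ f {m n} → m ≤ n → phase f m ≤ phase f n
phase-mono f {m} {zero}  z≤n = ≤-refl
phase-mono f {m} {suc n} m≤1+n with m≤n⇒m<n∨m≡n m≤1+n
... | inj₁ (s≤s m≤n) = ≤-trans (phase-mono f m≤n) (phase-≤suc f n)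
... | inj₂ refl      = ≤-refl

-- Phases rise by at most one at a time, so some `m` takes the phase from `u` to `suc u`, which
-- happens only if the colour read is `u % 3`.
phase-passes : ∀ f {a b u} → phase f a ≤ u → u < phase f b → ∃ λ m → a ≤ m × f m ≡ u % 3
phase-passes f {a} {suc b} {u} lo hi with u <? phase f b
... | yes u<b = phase-passes f {a} {b} lo u<b
... | no  u≮b with ≡χ (f b) (phase f b % 3) in eq | ≡χ-indicates (f b) (phase f b % 3)
...   | _ | fails _  = ⊥-elim (u≮b hi)
...   | _ | holds fb = b , a≤b , trans fb (cong (_% 3) (≤-antisym (≮⇒≥ u≮b) (≤-pred hi)))
  where
  a≤b : a ≤ b
  a≤b with <-≤-connex b a
  ... | inj₂ a≤b = a≤b
  -- Here `phase f (suc b) ≤ phase f a ≤ u` contradicts `hi`; `eq` restores the indicator that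
  -- matching has replaced by 1.
  ... | inj₁ b<a = ⊥-elim (<⇒≱ hi (≤-trans (≤-reflexive (sym (cong (_+ phase f b) eq))) (≤-trans (phase-mono f b<a) lo)))

-- A phase p contains no point of colour p mod 3, hence only one colour on each side.
excluded : ∀ f n → ¬ f n ≡ phase f (suc n) % 3
excluded f n with ≡χ (f n) (phase f n % 3) | ≡χ-indicates (f n) (phase f n % 3)
... | _ | fails fn = fn
... | _ | holds fn = λ eq → clash (m%n<n (phase f n) 3) (trans (sym fn) (trans eq (%-distribˡ-+ 1 (phase f n) 3)))
  where
  clash : ∀ {r} → r < 3 → ¬ r ≡ suc r % 3
  clash = <3-cases (λ r → ¬ r ≡ suc r % 3) (λ ()) (λ ()) (λ ())

third-residue : ∀ p {x} → x < 3 → ¬ x ≡ p % 3 → ¬ x ≡ suc p % 3 → x ≡ (2 + p % 3) % 3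
third-residue p x<3 x≢p x≢1+p =
  check (m%n<n p 3) x<3 x≢p (x≢1+p ∘ flip trans (sym (%-distribˡ-+ 1 p 3)))
  where
  Third : ℕ → ℕ → Set
  Third r x = ¬ x ≡ r → ¬ x ≡ suc r % 3 → x ≡ (2 + r) % 3
  check : ∀ {r} → r < 3 → ∀ {x} → x < 3 → Third r x
  check = <3-cases (λ r → ∀ {x} → x < 3 → Third r x)
    (<3-cases (Third 0) (λ a _ → ⊥-elim (a refl)) (λ _ b → ⊥-elim (b refl)) (λ _ _ → refl))
    (<3-cases (Third 1) (λ _ _ → refl) (λ a _ → ⊥-elim (a refl)) (λ _ b → ⊥-elim (b refl)))
    (<3-cases (Third 2) (λ _ b → ⊥-elim (b refl)) (λ _ _ → refl) (λ a _ → ⊥-elim (a refl)))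

-- Good is the side of each phase along which the chain may run on for ever:
-- the lower one for ascending chains, the upper one for descending chains.

module Chain (f : Baire) (f<3 : Colouring f) (Good Bad : ℕ → Set)
  (disjoint : ∀ {n} → Good n → Bad n → ⊥)
  (monochromatic : ∀ {a b} → Good a → Good b → phase f (suc a) ≡ phase f (suc b) → f a ≡ f b)
  where

  -- How a point `b` read after `a` can lie ahead of `a` in the direction of the chain. If both are
  -- good, a later phase would put `b` behind `a`; if both are bad, the same phase would.
  Later : ℕ → ℕ → Set
  Later a b = (Good a × Good b × phase f (suc a) ≡ phase f (suc b)) ⊎
              (Bad b × (Good a ⊎ phase f (suc a) < phase f (suc b)))

  -- `T` stands for the stages of the chain; `extend` is drawn from the finiteness of the part of
  -- the chain behind each point.
  module _ (T : ℕ → Set) (extend : ∀ {a} → T a → ∀ n → ∃ λ b → T b × n ≤ b × Later a b) where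

    next-bad : ∀ {a} → T a → Bad a → ∃ λ b → T b × Bad b × phase f (suc a) < phase f (suc b)
    next-bad Ta bad with extend Ta 0
    ... | b , Tb , _ , inj₁ (good , _)          = ⊥-elim (disjoint good bad)
    ... | b , Tb , _ , inj₂ (_ , inj₁ good)     = ⊥-elim (disjoint good bad)
    ... | b , Tb , _ , inj₂ (bad-b , inj₂ lt)   = b , Tb , bad-b , lt

    -- A bad point forces infinitely many phases, and three phase changes see every colour.
    colour-recurs : ∀ {e} → T e → ∀ n → ∃ λ m → n ≤ m × f m ≡ f e
    colour-recurs {e} Te n with extend Te n
    ... | b , _ , n≤b , inj₁ (good-e , good-b , same) = b , n≤b , monochromatic good-b good-e (sym same)
    ... | b , Tb , n≤b , inj₂ (bad-b , _)
      with c , Tc , bad-c , b<c ← next-bad Tb bad-b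
      with d , Td , bad-d , c<d ← next-bad Tc bad-c
      with g , _  , _     , d<g ← next-bad Td bad-d
      -- The phases of `b`, `c`, `d`, `g` increase strictly, so at least three phase values are left
      -- between `b` and `g`, and one of them has residue `f e`.
      with u , lo , hi , eq ← three-residues (phase f (suc b)) (f<3 e)
      with m , b<m , fm ← phase-passes f {suc b} {suc g} lo
             (<-≤-trans hi (≤-trans (s≤s (≤-trans (s≤s b<c) c<d)) d<g))
      = m , ≤-trans n≤b (<⇒≤ b<m) , trans fm (sym eq)

-- Correctness of the order and colours along its chains

module Correctness (f : Baire) (f<3 : Colouring f) where

  -- The prefix grows by at least one, which after multiplication by 3 outweighs the last digit
  -- `f n`.
  element-step : ∀ n → element f n < element f (suc n)
  element-step n = begin-strict
    f n + prefix f n * 3                                   <⟨ +-monoˡ-< (prefix f n * 3) (f<3 n) ⟩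
    (1 + prefix f n) * 3                                   ≤⟨ *-monoˡ-≤ 3 (+-monoˡ-≤ (prefix f n) 1≤digit) ⟩
    prefix f (suc n) * 3                                   ≤⟨ m≤n+m _ (f (suc n)) ⟩
    f (suc n) + prefix f (suc n) * 3                       ∎
    where
    open ≤-Reasoning
    1≤digit : 1 ≤ (2 + f n) * 3 ^ n
    1≤digit = *-mono-≤ {1} {2 + f n} (s≤s z≤n) (m^n>0 3 n)

  open StrictlyIncreasing (element f) element-step

  open LinOrd (order f)

  element-isElement : ∀ n → IsElement f (element f n)
  element-isElement n = cong (element f) (inverse-of n)

  InL⇒isElement : ∀ {x} → InL x → IsElement f x
  InL⇒isElement {x} p = proj₁ (≤L⇒≤E f x x p)

  isElement⇒InL : ∀ {x} → IsElement f x → InL x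
  isElement⇒InL {x} p = ≤E⇒≤L f x x (p , p , ≼-refl f (stage f x))

  isLinearOrder : IsLinearOrder
  isLinearOrder = (λ p → indicator≤1 (order-indicates f p)) , field-of , antisym , transitive , total
    where
    field-of : ∀ x y → x ≤L y → InL x × InL y
    field-of x y le = let p , q , _ = ≤L⇒≤E f x y le in isElement⇒InL {x} p , isElement⇒InL {y} q

    antisym : ∀ x y → x ≤L y → y ≤L x → x ≡ y
    antisym x y le ge = let p , q , i = ≤L⇒≤E f x y le ; _ , _ , j = ≤L⇒≤E f y x ge in
      trans (sym p) (trans (cong (element f) (≼-antisym f {stage f x} {stage f y} i j)) q)

    transitive : ∀ x y z → x ≤L y → y ≤L z → x ≤L z
    transitive x y z le le′ = let p , _ , i = ≤L⇒≤E f x y le ; _ , q , j = ≤L⇒≤E f y z le′ in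
      ≤E⇒≤L f x z (p , q , ≼-trans f {stage f x} {stage f y} {stage f z} i j)

    total : ∀ x y → InL x → InL y → x ≤L y ⊎ y ≤L x
    total x y Lx Ly with InL⇒isElement {x} Lx | InL⇒isElement {y} Ly | ≼-total f (stage f x) (stage f y)
    ... | p | q | inj₁ i = inj₁ (≤E⇒≤L f x y (p , q , i))
    ... | p | q | inj₂ i = inj₂ (≤E⇒≤L f y x (q , p , i))

  infiniteL : InfiniteL
  infiniteL n = element f n , n≤vn n , isElement⇒InL {element f n} (element-isElement n)

  monochromatic-lower : ∀ {a b} → Lower f a → Lower f b → phase f (suc a) ≡ phase f (suc b) → f a ≡ f b
  monochromatic-lower p q same = trans p (trans (cong (λ t → suc t % 3) same) (sym q))

  monochromatic-upper : ∀ {a b} → ¬ Lower f a → ¬ Lower f b → phase f (suc a) ≡ phase f (suc b) → f a ≡ f b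
  monochromatic-upper {a} {b} p q same = trans (colour a p)
    (trans (cong (λ t → (2 + t % 3) % 3) same) (sym (colour b q)))
    where
    colour : ∀ n → ¬ Lower f n → f n ≡ (2 + phase f (suc n) % 3) % 3
    colour n = third-residue (phase f (suc n)) (f<3 n) (excluded f n)

  module Below = Chain f f<3 (Lower f) (λ n → ¬ Lower f n) (λ p ¬p → ¬p p) monochromatic-lower
  module Above = Chain f f<3 (λ n → ¬ Lower f n) (Lower f) (λ ¬p p → ¬p p) monochromatic-upper

  -- As `a < b`, two cases are impossible: lower points with `b` in an earlier phase, and upper
  -- points of one phase with `b ≤ a`.
  ≼⇒Later : ∀ {a b} → a < b → f ⊢ a ≼ b → Below.Later a b
  ≼⇒Later a<b (inj₁ (p , q)) = inj₂ (q , inj₁ p)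
  ≼⇒Later a<b (inj₂ (inj₁ (p , q , inj₁ lt))) = ⊥-elim (<⇒≱ lt (phase-mono f (s≤s (<⇒≤ a<b))))
  ≼⇒Later a<b (inj₂ (inj₁ (p , q , inj₂ (eq , _)))) = inj₁ (p , q , sym eq)
  ≼⇒Later a<b (inj₂ (inj₂ (p , q , inj₁ lt))) = inj₂ (q , inj₂ lt)
  ≼⇒Later a<b (inj₂ (inj₂ (p , q , inj₂ (_ , b≤a)))) = ⊥-elim (<⇒≱ a<b b≤a)

  ≽⇒Later : ∀ {a b} → a < b → f ⊢ b ≼ a → Above.Later a b
  ≽⇒Later a<b (inj₁ (p , q)) = inj₂ (p , inj₁ q)
  ≽⇒Later a<b (inj₂ (inj₁ (p , q , inj₁ lt))) = inj₂ (p , inj₂ lt)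
  ≽⇒Later a<b (inj₂ (inj₁ (p , q , inj₂ (_ , b≤a)))) = ⊥-elim (<⇒≱ a<b b≤a)
  ≽⇒Later a<b (inj₂ (inj₂ (p , q , inj₁ lt))) = ⊥-elim (<⇒≱ lt (phase-mono f (s≤s (<⇒≤ a<b))))
  ≽⇒Later a<b (inj₂ (inj₂ (p , q , inj₂ (eq , _)))) = inj₁ (q , p , sym eq)

  module Solution (s : Baire) (infinite : InfiniteSet s) (s⊆L : ∀ x → x ∈ₛ s → InL x) where

    Stages : ℕ → Set
    Stages n = element f n ∈ₛ s

    s⇒Stages : ∀ {x} → x ∈ₛ s → Stages (stage f x)
    s⇒Stages {x} x∈s = subst (_∈ₛ s) (sym (InL⇒isElement {x} (s⊆L x x∈s))) x∈s

    far : ∀ n → ∃ λ b → Stages b × n ≤ b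
    far n with infinite (element f n)
    ... | x , le , x∈s = stage f x , s⇒Stages x∈s , ≤-pred (cancel-< (≤-<-trans le (inverse-upper x)))

    -- `m` bounds an element and not a stage, but `b ≤ element f b`, so going beyond one maximum
    -- meets all three demands.
    extend-far : ∀ {a} n m → ∃ λ b → Stages b × n ≤ b × m ≤ element f b × a < b
    extend-far {a} n m with far (n ⊔ m ⊔ suc a)
    ... | b , Tb , le =
      b , Tb , ≤-trans (m≤m⊔n n m) (m⊔n≤o⇒m≤o _ _ le)
        , ≤-trans (m≤n⊔m n m) (≤-trans (m⊔n≤o⇒m≤o _ _ le) (n≤vn b)) , m⊔n≤o⇒n≤o (n ⊔ m) _ le

    ≼-element : ∀ {a b} → f ⊢ a ≼ b → element f a ≤L element f b
    ≼-element {a} {b} le = ≤E⇒≤L f (element f a) (element f b) (element-isElement a , element-isElement b ,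
      subst₂ (f ⊢_≼_) (sym (inverse-of a)) (sym (inverse-of b)) le)

    element-injective : ∀ {a b} → element f a ≡ element f b → a ≡ b
    element-injective {a} {b} eq = trans (sym (inverse-of a)) (trans (cong (stage f) eq) (inverse-of b))

    -- Chain elements under `element f a` are smaller than `m` as numbers, so by totality a chain
    -- element from `m` on with a stage beyond `a` lies above it.
    extend-asc : Ascending s → ∀ {a} → Stages a → ∀ n → ∃ λ b → Stages b × n ≤ b × Below.Later a b
    extend-asc asc {a} Ta n with asc (element f a) Ta
    ... | m , bound with extend-far {a} n m
    ...   | b , Tb , n≤b , m≤b , a<b with ≼-total f a b
    ...     | inj₁ a≼b = b , Tb , n≤b , ≼⇒Later {a} {b} a<b a≼b
    ...     | inj₂ b≼a = ⊥-elim (<⇒≱ (bound _ Tb (≼-element {b} {a} b≼a , λ eq → <-irrefl (sym (element-injective eq)) a<b)) m≤b)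

    extend-desc : Descending s → ∀ {a} → Stages a → ∀ n → ∃ λ b → Stages b × n ≤ b × Above.Later a b
    extend-desc desc {a} Ta n with desc (element f a) Ta
    ... | m , bound with extend-far {a} n m
    ...   | b , Tb , n≤b , m≤b , a<b with ≼-total f a b
    ...     | inj₂ b≼a = b , Tb , n≤b , ≽⇒Later {a} {b} a<b b≼a
    ...     | inj₁ a≼b = ⊥-elim (<⇒≱ (bound _ Tb (≼-element {a} {b} a≼b , λ eq → <-irrefl (element-injective eq) a<b)) m≤b)

    colour-recurs : Ascending s ⊎ Descending s → ∀ {e} → Stages e → ∀ n → ∃ λ m → n ≤ m × f m ≡ f e
    colour-recurs (inj₁ asc)  = Below.colour-recurs Stages (extend-asc asc)
    colour-recurs (inj₂ desc) = Above.colour-recurs Stages (extend-desc desc)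

    -- The reason for putting `f n` in the last digit: the colour of a chain point can be read
    -- without knowing its stage.
    element-colour : ∀ {x} → x ∈ₛ s → x % 3 ≡ f (stage f x)
    element-colour {x} x∈s = trans (cong (_% 3) (sym (InL⇒isElement {x} (s⊆L x x∈s)))) (digit+3*-% (prefix f (stage f x)) (f<3 _))

    shift-element : ∀ k {x} → x ∈ₛ s → shift (suc k) x ≡ shift k (prefix f (stage f x))
    shift-element k {x} x∈s =
      trans (cong (shift (suc k)) (sym (InL⇒isElement {x} (s⊆L x x∈s)))) (shift-digit k (prefix f (stage f x)) (f<3 _))

-- The functional Ψ

absent : Computable {2} (λ g xs → 1 ∸ g (lookup xs 0F))
absent = constC 1 ∸C oracleC (var 0F)

-- The `2 + m` deleted digits are the point's own colour and `f 0`, ..., `f m`. If anything remains,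
-- `x` is long enough to record `f m`.
absent-or-short : Computable {2} (λ g xs → (1 ∸ g (lookup xs 0F)) + (1 ∸ shift (2 + lookup xs 1F) (lookup xs 0F)))
absent-or-short = absent +C (constC 1 ∸C shiftC (constC 2 +C var 1F) (var 0F))

-- The arguments are `m`, the least chain element and a long chain element. One extra shift skips
-- the own colour of the latter.
same-colour : Computable {3} (λ g xs → ≡χ (shift (suc (lookup xs 0F)) (lookup xs 2F) % 3) (lookup xs 1F % 3))
same-colour = ≡χC (%3C (shiftC (sucC (var 0F)) (var 2F))) (%3C (var 1F))

-- The first search returns the least chain element for every input, so a single colour is fixed
-- throughout.
backward : Code 1
backward = cmp (code same-colour) (prj 0F ∷ mnz (code absent) ∷ mnz (code absent-or-short) ∷ [])

1∸n≡0⇒0<n : ∀ {n} → 1 ∸ n ≡ 0 → 0 < n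
1∸n≡0⇒0<n = m∸n≡0⇒m≤n

backward-correct : ∀ f → Colouring f → ∀ s → Problem.sol ADC (order f) s →
                   ∃ λ h → (backward ⟦ s ⟧≡ h) × Problem.sol RT13 f h
backward-correct f f<3 s (s≤1 , infinite , s⊆L , chain) = h , computes , h≤1 , h-infinite , f e , h-colour
  where
  open Correctness f f<3
  open Solution s infinite s⊆L

  0<⇒∈ : ∀ {x} → 0 < s x → x ∈ₛ s
  0<⇒∈ {x} = ≤-antisym (s≤1 x)

  first = let x , _ , x∈s = infinite 0 in least-zero (λ x → 1 ∸ s x) x (cong (1 ∸_) x∈s)
  x₀ = proj₁ first
  e = stage f x₀

  x₀∈s : x₀ ∈ₛ s
  x₀∈s = 0<⇒∈ (1∸n≡0⇒0<n (proj₁ (proj₂ first)))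

  h : Baire
  h m = ≡χ (f m) (f e)

  h≤1 : IsSetCode h
  h≤1 m = indicator≤1 (≡χ-indicates (f m) (f e))

  h-colour : ∀ m → m ∈ₛ h → f m ≡ f e
  h-colour m = indicator-sound (≡χ-indicates (f m) (f e))

  h-infinite : InfiniteSet h
  h-infinite n with colour-recurs chain {e} (s⇒Stages x₀∈s) n
  ... | m , n≤m , eq = m , n≤m , indicator-complete (≡χ-indicates (f m) (f e)) eq

  long : ∀ m → ∃ λ x → (1 ∸ s x) + (1 ∸ shift (2 + m) x) ≡ 0
  -- The second search terminates because an infinite chain has a stage beyond `m`.
  long m with far (suc m)
  ... | b , b∈s , m<b = element f b , cong₂ _+_ (cong (1 ∸_) b∈s)
    (m≤n⇒m∸n≡0 (subst (0 <_) (sym (shift-digit (suc m) (prefix f b) (f<3 b))) (prefix-long f<3 m<b)))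

  computes : backward ⟦ s ⟧≡ h
  computes m with least-zero _ _ (proj₂ (long m))
  ... | x , found , minimal = subst (Eval s backward (m ∷ [])) (cong₂ ≡χ digit (element-colour x₀∈s))
    (ev-cmp (evs-∷ ev-prj
              (evs-∷ (minimize absent s (m ∷ []) (proj₁ (proj₂ first)) (proj₂ (proj₂ first)))
                (evs-∷ (minimize absent-or-short s (m ∷ []) found minimal) evs-[])))
            (correct same-colour s (m ∷ x₀ ∷ x ∷ [])))
    where
    x∈s : x ∈ₛ s
    x∈s = 0<⇒∈ (1∸n≡0⇒0<n (m+n≡0⇒m≡0 _ found))

    m<stage : m < stage f x
    m<stage = prefix-short f<3 (subst (0 <_) (shift-element (suc m) x∈s)
      (1∸n≡0⇒0<n (m+n≡0⇒n≡0 (1 ∸ s x) found)))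

    digit : shift (suc m) x % 3 ≡ f m
    digit = trans (cong (_% 3) (shift-element m x∈s)) (prefix-digit f<3 m<stage)

theorem4p22 : RT13 ≤sW ADC
theorem4p22 = code (χC orderD) , backward , λ f f<3 →
  let open Correctness f f<3 in
  order f , (λ n → correct (χC orderD) f (n ∷ [])) , (isLinearOrder , infiniteL) , backward-correct f f<3
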